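{- Let $F : \mathsf{Set} \to \mathsf{Set}$ be a finitary functor which preserves pullbacks of monomorphisms. Let $\rho$ be an uncountable regular ordinal. Then $F$ preserves $\rho^{\mathrm{op}}$-indexed limits: for every functor $X : \rho^{\mathrm{op}} \to \mathsf{Set}$ (i.e. a family of sets $(X_\alpha)_{\alpha<\rho}$ with restriction maps $X_\alpha \to X_\beta$ for $\beta \le \alpha$, compatible with composition), the canonical comparison map $F(\lim_{\alpha<\rho} X_\alpha) \to \lim_{\alpha<\rho} F(X_\alpha)$ is a bijection.
   Context: A functor $F:\mathsf{Set}\to\mathsf{Set}$ is finitary if it preserves directed colimits. $F$ preserves pullbacks of monomorphisms if for every pullback square $A \to B$, $A \to C$, $B \rightarrowtail D$, $C \to D$ in $\mathsf{Set}$ in which $B \to D$ is a monomorphism, the image of the square under $F$ is again a pullback square. An ordinal $\rho$ is regular if it is a limit ordinal equal to its own cofinality (every subset of $\rho$ of cardinality smaller than $\rho$ is bounded in $\rho$); here $\rho$ is moreover assumed uncountable. The ordinal $\rho$ is viewed as a poset category, and $\rho^{\mathrm{op}}$ is its opposite. -}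

module Defs where

open import Level using (Level; suc)
open import Data.Nat.Base using (ℕ)
open import Data.Product using (Σ-syntax; ∃; ∃!; _×_; _,_; proj₁; proj₂)
open import Function.Bundles using (Func; _⟨$⟩_; Injection; Bijection)
open import Function.Construct.Composition using () renaming (function to compose)
open import Function.Construct.Identity using () renaming (function to identity)
import Function.Relation.Binary.Setoid.Equality as FuncEquality
open import Induction.WellFounded using (WellFounded)
open import Relation.Binary.Bundles using (Setoid; Poset; StrictTotalOrder; DecTotalOrder)
import Relation.Binary.Construct.On as On
import Relation.Binary.Properties.Poset as PosetProperties
import Relation.Binary.Properties.StrictTotalOrder as StrictTotalOrderProperties
open import Relation.Binary.PropositionalEquality.Properties using (setoid)
open import Relation.Nullary.Negation.Core using (¬_)

-- The category of sets is rendered as the category of small setoids `Setoid ℓ ℓ`,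
-- with maps `Func` compared pointwise; quotients, hence colimits, exist there.

infix  4 _≋_
infixr 9 _⊙_

_≋_ : {ℓ : Level} {A B : Setoid ℓ ℓ} (f g : Func A B) → Set ℓ
_≋_ {A = A} {B = B} = FuncEquality._≈_ A B

idₛ : {ℓ : Level} {A : Setoid ℓ ℓ} → Func A A
idₛ {A = A} = identity A

_⊙_ : {ℓ : Level} {A B C : Setoid ℓ ℓ} → Func B C → Func A B → Func A C
g ⊙ f = compose f g

IsMono : {ℓ : Level} {A B : Setoid ℓ ℓ} → Func A B → Set (suc ℓ)
IsMono {ℓ} {A} m = {Z : Setoid ℓ ℓ} (g h : Func Z A) → m ⊙ g ≋ m ⊙ h → g ≋ h

--     p
--   A → B
-- q ↓   ↓ m
--   C → D
--     n
record IsPullback {ℓ : Level} {A B C D : Setoid ℓ ℓ}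
                  (p : Func A B) (q : Func A C) (m : Func B D) (n : Func C D) :
                  Set (suc ℓ) where
  field
    commutes  : m ⊙ p ≋ n ⊙ q
    universal : {Z : Setoid ℓ ℓ} (h : Func Z B) (k : Func Z C) → m ⊙ h ≋ n ⊙ k →
                ∃! _≋_ λ (u : Func Z A) → (p ⊙ u ≋ h) × (q ⊙ u ≋ k)

record Functor (ℓ : Level) : Set (suc ℓ) where
  field
    F₀     : Setoid ℓ ℓ → Setoid ℓ ℓ
    F₁     : {A B : Setoid ℓ ℓ} → Func A B → Func (F₀ A) (F₀ B)
    F-cong : {A B : Setoid ℓ ℓ} {f g : Func A B} → f ≋ g → F₁ f ≋ F₁ g
    F-id   : {A : Setoid ℓ ℓ} → F₁ (idₛ {A = A}) ≋ idₛ
    F-∘    : {A B C : Setoid ℓ ℓ} (g : Func B C) (f : Func A B) →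
             F₁ (g ⊙ f) ≋ F₁ g ⊙ F₁ f

-- A functor from the poset category P to sets.  Hom-sets of P have at most one
-- element, so `map` must not depend on the proof of i ≤ j (`map-cong`).
record Diagram {ℓ : Level} (P : Poset ℓ ℓ ℓ) : Set (suc ℓ) where
  open Poset P using (Carrier; _≤_; refl; trans)
  field
    obj      : Carrier → Setoid ℓ ℓ
    map      : {i j : Carrier} → i ≤ j → Func (obj i) (obj j)
    map-cong : {i j : Carrier} (p q : i ≤ j) → map p ≋ map q
    map-id   : {i : Carrier} → map (refl {i}) ≋ idₛ
    map-∘    : {i j k : Carrier} (p : i ≤ j) (q : j ≤ k) →
               map (trans p q) ≋ map q ⊙ map p

module _ {ℓ : Level} {P : Poset ℓ ℓ ℓ} where

  open Poset P using (Carrier; _≤_)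

  record Cocone (D : Diagram P) : Set (suc ℓ) where
    open Diagram D
    field
      apex     : Setoid ℓ ℓ
      ι        : (i : Carrier) → Func (obj i) apex
      commutes : {i j : Carrier} (p : i ≤ j) → ι j ⊙ map p ≋ ι i

  IsColimit : {D : Diagram P} → Cocone D → Set (suc ℓ)
  IsColimit {D} K = (L : Cocone D) →
    ∃! _≋_ λ (u : Func (Cocone.apex K) (Cocone.apex L)) →
      (i : Carrier) → u ⊙ Cocone.ι K i ≋ Cocone.ι L i

  Lim : Diagram P → Setoid ℓ ℓ
  Lim D = record
    { Carrier       = Σ[ x ∈ ((i : Carrier) → Setoid.Carrier (obj i)) ]
                      ({i j : Carrier} (p : i ≤ j) → Setoid._≈_ (obj j) (map p ⟨$⟩ x i) (x j))
    ; _≈_           = λ x y → (i : Carrier) → Setoid._≈_ (obj i) (proj₁ x i) (proj₁ y i)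
    ; isEquivalence = record
      { refl  = λ i → Setoid.refl (obj i)
      ; sym   = λ x≈y i → Setoid.sym (obj i) (x≈y i)
      ; trans = λ x≈y y≈z i → Setoid.trans (obj i) (x≈y i) (y≈z i)
      }
    }
    where open Diagram D

  π : (D : Diagram P) (i : Carrier) → Func (Lim D) (Diagram.obj D i)
  π D i = record { to = λ x → proj₁ x i ; cong = λ x≈y → x≈y i }

  module _ (F : Functor ℓ) where

    open Functor F

    mapDiagram : Diagram P → Diagram P
    mapDiagram D = record
      { obj      = λ i → F₀ (obj i)
      ; map      = λ p → F₁ (map p)
      ; map-cong = λ p q → F-cong (map-cong p q)
      ; map-id   = λ {i} x → Setoid.trans (F₀ (obj i)) (F-cong map-id x) (F-id x)
      ; map-∘    = λ {_} {_} {k} p q x →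
          Setoid.trans (F₀ (obj k)) (F-cong (map-∘ p q) x) (F-∘ (map q) (map p) x)
      }
      where open Diagram D

    mapCocone : {D : Diagram P} → Cocone D → Cocone (mapDiagram D)
    mapCocone {D} K = record
      { apex     = F₀ apex
      ; ι        = λ i → F₁ (ι i)
      ; commutes = λ {i} {j} p x → Setoid.trans (F₀ apex)
          (Setoid.sym (F₀ apex) (F-∘ (ι j) (map p) x))
          (F-cong (commutes p) x)
      }
      where
      open Diagram D
      open Cocone K

    comparison : (D : Diagram P) → Func (F₀ (Lim D)) (Lim (mapDiagram D))
    comparison D = record
      { to   = λ a →
          (λ i → F₁ (π D i) ⟨$⟩ a) ,
          (λ {i} {j} p → Setoid.trans (F₀ (obj j))
            (Setoid.sym (F₀ (obj j)) (F-∘ (map p) (π D i) a))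
            (F-cong {f = map p ⊙ π D i} {g = π D j} (λ x → proj₂ x p) a))
      ; cong = λ a≈b i → Func.cong (F₁ (π D i)) a≈b
      }
      where open Diagram D

record IsDirected {ℓ : Level} (P : Poset ℓ ℓ ℓ) : Set ℓ where
  open Poset P using (Carrier; _≤_)
  field
    inhabited  : Carrier
    upperBound : (i j : Carrier) → ∃ λ k → (i ≤ k) × (j ≤ k)

IsFinitary : {ℓ : Level} → Functor ℓ → Set (suc ℓ)
IsFinitary {ℓ} F = (P : Poset ℓ ℓ ℓ) → IsDirected P →
  (D : Diagram P) (K : Cocone D) → IsColimit K → IsColimit (mapCocone F K)

PreservesPullbacksOfMonos : {ℓ : Level} → Functor ℓ → Set (suc ℓ)
PreservesPullbacksOfMonos {ℓ} F = {A B C D : Setoid ℓ ℓ}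
  (p : Func A B) (q : Func A C) (m : Func B D) (n : Func C D) →
  IsMono m → IsPullback p q m n → IsPullback (F₁ p) (F₁ q) (F₁ m) (F₁ n)
  where open Functor F

-- Ordinals are represented by well-ordered sets.
record Ordinal (ℓ : Level) : Set (suc ℓ) where
  field
    strictTotalOrder : StrictTotalOrder ℓ ℓ ℓ
  open StrictTotalOrder strictTotalOrder public using (Carrier; _≈_; _<_)
  field
    <-wellFounded : WellFounded _<_

  carrierSetoid : Setoid ℓ ℓ
  carrierSetoid = StrictTotalOrder.Eq.setoid strictTotalOrder

  poset : Poset ℓ ℓ ℓ
  poset = DecTotalOrder.poset (StrictTotalOrderProperties.decTotalOrder strictTotalOrder)

  open Poset poset public using (_≤_)

  oppositePoset : Poset ℓ ℓ ℓ
  oppositePoset = PosetProperties.≥-poset poset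

  subset : (Carrier → Set ℓ) → Setoid ℓ ℓ
  subset S = On.setoid {B = ∃ S} carrierSetoid proj₁

  -- |S| is an ordinal below ρ: S is equinumerous with the proper initial segment
  -- {β ∣ β < α}, i.e. with the ordinal α, for some α < ρ.
  HasSmallerCardinality : (Carrier → Set ℓ) → Set ℓ
  HasSmallerCardinality S = ∃ λ α → Bijection (subset S) (subset (_< α))

  IsBounded : (Carrier → Set ℓ) → Set ℓ
  IsBounded S = ∃ λ β → (α : Carrier) → S α → α ≤ β

  record IsLimitOrdinal : Set ℓ where
    field
      nonZero   : Carrier
      noMaximum : (α : Carrier) → ∃ λ β → α < β

  record IsRegular : Set (suc ℓ) where
    field
      isLimit : IsLimitOrdinal
      bounded : (S : Carrier → Set ℓ) → HasSmallerCardinality S → IsBounded S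

  IsUncountable : Set ℓ
  IsUncountable = ¬ Injection carrierSetoid (setoid ℕ)

{-# OPTIONS --safe #-}

-- Every a ∈ F X is supported by a finite subset of X, i.e. comes from F S for some
-- finite S ⊆ X, because X is the directed colimit of its finite subsets.  As F
-- preserves preimages of subsets, a support of minimal size is the least support,
-- and F f maps the least support of a onto the least support of F f a.
-- Injectivity: two elements of F (Lim X) have a common finite support T, and some
-- projection Lim X → X α is injective on T.
-- Surjectivity: for a thread (a α) the size of the least support of a α is a monotone
-- function ρ → ℕ, which attains its maximum because ρ is regular and uncountable.
-- From then on the restriction maps between the supports are bijections, so each
-- point of the support extends to a thread of X, and these threads support a preimage.
module Submission where

open import Defs
open import Level using (Level; _⊔_)
open import Axiom.ExcludedMiddle using (ExcludedMiddle)
open import Data.Nat.Base as ℕ using (ℕ; zero; suc)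
import Data.Nat.Properties as ℕ
import Data.Nat.Induction as ℕ
open import Data.List.Base using (List; []; _∷_; _++_; [_]; length; map; filter)
open import Data.List.Properties using (length-map; filter-notAll)
import Data.List.Membership.Setoid as Membership
import Data.List.Membership.Setoid.Properties as Membershipₚ
open import Data.List.Relation.Unary.All as All using (All; []; _∷_)
open import Data.List.Relation.Unary.Any as Any using (here)
import Data.List.Relation.Binary.Subset.Setoid as Subset
open import Data.Product.Base using (∃; _×_; _,_; proj₁; proj₂)
open import Data.Sum.Base using (inj₁; inj₂)
open import Data.Unit.Polymorphic.Base using (⊤; tt)
open import Function.Base using (_∘_)
open import Function.Bundles using (Func; _⟨$⟩_; Bijection)
open import Function.Definitions using (Bijective; Injective; StrictlySurjective)
open import Function.Consequences.Setoid using (strictlySurjective⇒surjective)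
open import Induction.WellFounded using (WellFounded; Acc; acc)
open import Relation.Binary.Bundles using (Setoid; Poset; StrictTotalOrder; DecTotalOrder)
open import Relation.Binary.Core using (Rel)
open import Relation.Binary.Definitions using (_Respects_; tri<; tri≈; tri>)
import Relation.Binary.Construct.Interior.Symmetric as Interior
import Relation.Binary.Construct.On as On
import Relation.Binary.Properties.StrictTotalOrder as StrictTotalOrderProperties
open import Relation.Binary.PropositionalEquality.Core as ≡ using (_≡_)
import Relation.Binary.Reasoning.Setoid as ≈-Reasoning
open import Relation.Nullary.Decidable.Core using (yes; no; decidable-stable)
open import Relation.Nullary.Negation.Core using (¬_; contradiction)

-- Descent along accessibility: excluded middle decides at each element whether a smaller one
-- satisfies `P`.
minimum : ∀ {a p r} {A : Set a} {_≺_ : Rel A r} → ExcludedMiddle (a ⊔ p ⊔ r) →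
          WellFounded _≺_ → (P : A → Set p) → ∃ P →
          ∃ λ m → P m × (∀ y → P y → ¬ (y ≺ m))
minimum {_≺_ = _≺_} em wf P (x₀ , px₀) = go x₀ px₀ (wf x₀)
  where
  go : ∀ x → P x → Acc _≺_ x → ∃ λ m → P m × (∀ y → P y → ¬ (y ≺ m))
  go x px (acc rs) with em {∃ λ y → P y × y ≺ x}
  ... | yes (y , py , y≺x) = go y py (rs y≺x)
  ... | no  none           = x , px , λ y py y≺x → none (y , py , y≺x)

-- Ordinals

module OrdinalProperties {ℓ : Level} (em : ExcludedMiddle ℓ) (ρ : Ordinal ℓ) where

  open Ordinal ρ
  open StrictTotalOrder strictTotalOrder
    using (compare; module Eq; irrefl) renaming (trans to <-trans)
  open DecTotalOrder (StrictTotalOrderProperties.decTotalOrder strictTotalOrder)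
    using (total) renaming (refl to ≤-refl)

  module _ (c : ℕ → Carrier) (c-step : ∀ k → c k < c (suc k)) where

    sequence-mono : ∀ {j k} → j ℕ.< k → c j < c k
    sequence-mono {j} {suc k} (ℕ.s≤s j≤k) with ℕ.m≤n⇒m<n∨m≡n j≤k
    ... | inj₁ j<k    = <-trans (sequence-mono j<k) (c-step k)
    ... | inj₂ ≡.refl = c-step k

    sequence-injective : ∀ {j k} → c j ≈ c k → j ≡ k
    sequence-injective {j} {k} cj≈ck with ℕ.<-cmp j k
    ... | tri< j<k _ _ = contradiction (sequence-mono j<k) (irrefl cj≈ck)
    ... | tri≈ _ j≡k _ = j≡k
    ... | tri> _ _ k<j = contradiction (sequence-mono k<j) (irrefl (Eq.sym cj≈ck))

  module _ (lim : IsLimitOrdinal) where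

    open IsLimitOrdinal lim

    private
      least : ∃ λ m → ⊤ {ℓ} × (∀ β → ⊤ {ℓ} → ¬ (β < m))
      least = minimum em <-wellFounded (λ _ → ⊤) (nonZero , tt)

      next : ∀ α → ∃ λ m → α < m × (∀ β → α < β → ¬ (β < m))
      next α = minimum em <-wellFounded (α <_) (noMaximum α)

    -- The finite ordinals inside `ρ`: `least` is zero and `next` is the ordinal successor.
    finite : ℕ → Carrier
    finite zero    = proj₁ least
    finite (suc k) = proj₁ (next (finite k))

    finite-step : ∀ k → finite k < finite (suc k)
    finite-step k = proj₁ (proj₂ (next (finite k)))

    -- Nothing lies strictly between an element and its successor, so the finite ordinals form an
    -- initial segment.
    finite-initial : ∀ k {β} → β < finite k → ∃ λ j → finite j ≈ β
    finite-initial zero    {β} β<0 = contradiction β<0 (proj₂ (proj₂ least) β tt)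
    finite-initial (suc k) {β} β<  with compare β (finite k)
    ... | tri< β<k _ _ = finite-initial k β<k
    ... | tri≈ _ β≈k _ = k , Eq.sym β≈k
    ... | tri> _ _ k<β = contradiction β< (proj₂ (proj₂ (next (finite k))) β k<β)

    ω-exists : IsUncountable →
               ∃ λ ω → (∀ k → finite k < ω) × (∀ β → β < ω → ∃ λ k → finite k ≈ β)
    ω-exists uncountable = ω , finite<ω , below-ω
      where
      Infinite : Carrier → Set ℓ
      Infinite α = ¬ ∃ λ k → finite k ≈ α

      infinite-exists : ∃ Infinite
      infinite-exists = decidable-stable em λ none →
        -- If every element were some `finite k`, its index would inject `ρ` into `ℕ`.
        let index = λ α → decidable-stable em (λ ∄k → none (α , ∄k)) in
        uncountable record
          { to        = λ α → proj₁ (index α)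
          ; cong      = λ {α} {β} α≈β → sequence-injective finite finite-step
              (Eq.trans (proj₂ (index α)) (Eq.trans α≈β (Eq.sym (proj₂ (index β)))))
          ; injective = λ {α} {β} eq → Eq.trans (Eq.sym (proj₂ (index α)))
              (Eq.trans (Eq.reflexive (≡.cong finite eq)) (proj₂ (index β)))
          }

      leastInfinite : ∃ λ m → Infinite m × (∀ β → Infinite β → ¬ (β < m))
      leastInfinite = minimum em <-wellFounded Infinite infinite-exists

      ω : Carrier
      ω = proj₁ leastInfinite

      finite<ω : ∀ k → finite k < ω
      finite<ω k with compare (finite k) ω
      ... | tri< k<ω _ _ = k<ω
      ... | tri≈ _ k≈ω _ = contradiction (k , k≈ω) (proj₁ (proj₂ leastInfinite))
      ... | tri> _ _ ω<k = contradiction (finite-initial k ω<k) (proj₁ (proj₂ leastInfinite))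

      below-ω : ∀ β → β < ω → ∃ λ k → finite k ≈ β
      below-ω β β<ω = decidable-stable em λ inf → proj₂ (proj₂ leastInfinite) β inf β<ω

  module _ (regular : IsRegular) (uncountable : IsUncountable) where

    open IsRegular regular

    -- The bijection `c k ↦ finite k` identifies the range of `c` with the ordinal `ω`, which is an
    -- element of `ρ`, so regularity applies. Strict growth makes `k` recoverable from `c k`.
    sequence-bounded : (c : ℕ → Carrier) → (∀ k → c k < c (suc k)) →
                       ∃ λ β → ∀ k → c k ≤ β
    sequence-bounded c c-step =
      let β , bound = bounded Range (ω , range↔ω)
      in  β , λ k → bound (c k) (k , Eq.refl)
      where
      Range : Carrier → Set ℓ
      Range α = ∃ λ k → c k ≈ α

      e : ℕ → Carrier
      e = finite isLimit

      ω : Carrier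
      ω = proj₁ (ω-exists isLimit uncountable)

      range↔ω : Bijection (subset Range) (subset (_< ω))
      range↔ω = record
        { to        = λ (_ , k , _) → e k , proj₁ (proj₂ (ω-exists isLimit uncountable)) k
        ; cong      = λ { {_ , j , cj≈α} {_ , k , ck≈β} α≈β →
            Eq.reflexive (≡.cong e (sequence-injective c c-step
              (Eq.trans cj≈α (Eq.trans α≈β (Eq.sym ck≈β))))) }
        ; bijective =
            (λ { {_ , j , cj≈α} {_ , k , ck≈β} ej≈ek →
              Eq.trans (Eq.sym cj≈α) (Eq.trans
                (Eq.reflexive (≡.cong c (sequence-injective e (finite-step isLimit) ej≈ek)))
                ck≈β) })
          , λ (β , β<ω) →
              let k , ek≈β = proj₂ (proj₂ (ω-exists isLimit uncountable)) β β<ω in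
              (c k , k , Eq.refl) , λ { {_ , j , cj≈α} α≈ck →
                Eq.trans (Eq.reflexive (≡.cong e (sequence-injective c c-step
                  (Eq.trans cj≈α α≈ck)))) ek≈β }
        }

    -- Without a maximum, every value is exceeded later; iterating this gives an increasing sequence
    -- along which `n` is unbounded, yet the sequence has a bound in `ρ`.
    monotone-attains-maximum : (n : Carrier → ℕ) → (∀ {α β} → α ≤ β → n α ℕ.≤ n β) →
                               ∃ λ α → ∀ β → n β ℕ.≤ n α
    monotone-attains-maximum n n-mono = decidable-stable em λ noMax →
      let
        larger : ∀ α → ∃ λ β → n α ℕ.< n β
        larger α = decidable-stable em λ none →
          noMax (α , λ β → ℕ.≮⇒≥ λ nα<nβ → none (β , nα<nβ))
      in absurd larger
      where
      reflects-< : ∀ {α β} → n α ℕ.< n β → α < β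
      reflects-< {α} {β} nα<nβ with compare α β
      ... | tri< α<β _ _ = α<β
      ... | tri≈ _ α≈β _ = contradiction (n-mono (inj₂ (Eq.sym α≈β))) (ℕ.<⇒≱ nα<nβ)
      ... | tri> _ _ β<α = contradiction (n-mono (inj₁ β<α)) (ℕ.<⇒≱ nα<nβ)

      absurd : ¬ (∀ α → ∃ λ β → n α ℕ.< n β)
      -- At index `suc (n β)` the sequence already has a value above `n β`, although it stays below
      -- `β`.
      absurd larger = ℕ.<⇒≱ (n[c]-large (suc (n β))) (n-mono (c≤β (suc (n β))))
        where
        c : ℕ → Carrier
        c zero    = IsLimitOrdinal.nonZero isLimit
        c (suc k) = proj₁ (larger (c k))

        n[c]-large : ∀ k → k ℕ.≤ n (c k)
        n[c]-large zero    = ℕ.z≤n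
        n[c]-large (suc k) = ℕ.≤-trans (ℕ.s≤s (n[c]-large k)) (proj₂ (larger (c k)))

        bound : ∃ λ β → ∀ k → c k ≤ β
        bound = sequence-bounded c (λ k → reflects-< (proj₂ (larger (c k))))

        β   = proj₁ bound
        c≤β = proj₂ bound

  upperBound : ∀ α β → ∃ λ γ → (α ≤ γ) × (β ≤ γ)
  upperBound α β with total α β
  ... | inj₁ α≤β = β , α≤β , ≤-refl
  ... | inj₂ β≤α = α , ≤-refl , β≤α

  -- Upward closure lets finitely many stages be merged into one; `α₀` supplies the stage for the
  -- empty list.
  eventually-All : ∀ {a} {A : Set a} → Carrier → (P : A → Carrier → Set ℓ) →
                   (∀ x {α β} → α ≤ β → P x α → P x β) → (∀ x → ∃ (P x)) →
                   ∀ xs → ∃ λ α → All (λ x → P x α) xs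
  eventually-All α₀ P up ev []       = α₀ , []
  eventually-All α₀ P up ev (x ∷ xs) =
    let α , px      = ev x
        β , pxs     = eventually-All α₀ P up ev xs
        γ , α≤γ , β≤γ = upperBound α β
    in  γ , up x α≤γ px ∷ All.map (λ {y} → up y β≤γ) pxs

-- Subsets and colimits in setoids

module _ {ℓ : Level} where

  infix 4 _[_≈_]

  ∣_∣ : Setoid ℓ ℓ → Set ℓ
  ∣_∣ = Setoid.Carrier

  _[_≈_] : (X : Setoid ℓ ℓ) → ∣ X ∣ → ∣ X ∣ → Set ℓ
  X [ x ≈ y ] = Setoid._≈_ X x y

  Sub : (X : Setoid ℓ ℓ) → (∣ X ∣ → Set ℓ) → Setoid ℓ ℓ
  Sub X S = On.setoid {B = ∃ S} X proj₁

  incl : (X : Setoid ℓ ℓ) (S : ∣ X ∣ → Set ℓ) → Func (Sub X S) X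
  incl X S = record { to = proj₁ ; cong = λ x≈y → x≈y }

  restrict : {X Y : Setoid ℓ ℓ} {S : ∣ X ∣ → Set ℓ} {T : ∣ Y ∣ → Set ℓ} (f : Func X Y) →
             (∀ {x} → S x → T (f ⟨$⟩ x)) → Func (Sub X S) (Sub Y T)
  restrict f S→T = record
    { to   = λ (x , s) → f ⟨$⟩ x , S→T s
    ; cong = Func.cong f
    }

  -- Elements as maps out of a terminal object, so that universal properties can be applied to them.
  point : {X : Setoid ℓ ℓ} → ∣ X ∣ → Func (record { Carrier = ⊤ {ℓ} ; _≈_ = λ _ _ → ⊤ {ℓ} }) X
  point {X} x = record { to = λ _ → x ; cong = λ _ → Setoid.refl X }

  -- The union of the images of the legs is the apex of a cocone. The induced map into it, followed
  -- by the inclusion, is the identity by uniqueness.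
  colimit-jointly-surjective : {P : Poset ℓ ℓ ℓ} {D : Diagram P} (K : Cocone D) → IsColimit K →
    (c : ∣ Cocone.apex K ∣) → ∃ λ i → ∃ λ x → Cocone.apex K [ Cocone.ι K i ⟨$⟩ x ≈ c ]
  colimit-jointly-surjective {D = D} K colim c =
    let i , x , ιx≈ = proj₂ (u ⟨$⟩ c)
    in  i , x , Setoid.trans apex ιx≈ (Setoid.trans apex (Setoid.sym apex (id≈ c)) (id≈′ c))
    where
    open Cocone K

    image : Setoid ℓ ℓ
    image = Sub apex λ c → ∃ λ i → ∃ λ x → apex [ ι i ⟨$⟩ x ≈ c ]

    imageCocone : Cocone D
    imageCocone = record
      { apex     = image
      ; ι        = λ i → record
        { to   = λ x → ι i ⟨$⟩ x , i , x , Setoid.refl apex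
        ; cong = Func.cong (ι i)
        }
      ; commutes = commutes
      }

    u : Func apex image
    u = proj₁ (colim imageCocone)

    -- Uniqueness in `∃!` compares only with the chosen mediator, so the two endomaps are compared
    -- through `v`.
    v : Func apex apex
    v = proj₁ (colim K)

    id≈ : v ≋ incl apex _ ⊙ u
    id≈ = proj₂ (proj₂ (colim K)) {incl apex _ ⊙ u} (proj₁ (proj₂ (colim imageCocone)))

    id≈′ : v ≋ idₛ
    id≈′ = proj₂ (proj₂ (colim K)) {idₛ} (λ i x → Setoid.refl apex)

  module FiniteSubsets (X : Setoid ℓ ℓ) where

    open Membership X using (_∈_)
    open Subset X using (_⊆_)
    open Membershipₚ using (∈-++⁺ˡ; ∈-++⁺ʳ)

    -- Finite subsets are encoded as lists, and mutual inclusion serves as their equality.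
    inclusionPoset : Poset ℓ ℓ ℓ
    inclusionPoset = Interior.poset {R = _⊆_} (λ x∈xs → x∈xs) (λ p q x∈xs → q (p x∈xs))

    directed : IsDirected inclusionPoset
    directed = record
      { inhabited  = []
      ; upperBound = λ xs ys → xs ++ ys , ∈-++⁺ˡ X , ∈-++⁺ʳ X xs
      }

    diagram : Diagram inclusionPoset
    diagram = record
      { obj      = λ xs → Sub X (_∈ xs)
      ; map      = λ p → restrict idₛ p
      ; map-cong = λ _ _ _ → Setoid.refl X
      ; map-id   = λ _ → Setoid.refl X
      ; map-∘    = λ _ _ _ → Setoid.refl X
      }

    cocone : Cocone diagram
    cocone = record
      { apex     = X
      ; ι        = λ xs → incl X (_∈ xs)
      ; commutes = λ _ _ → Setoid.refl X
      }

    isColimit : IsColimit cocone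
    isColimit L = u , u-ι , λ {v} v-ι x → L.sym (v-ι [ x ] (x , here X.refl))
      where
      module X = Setoid X
      module L where
        open Cocone L public
        open Setoid apex public using (sym; trans)

      singleton⊆ : ∀ {x xs} → x ∈ xs → [ x ] ⊆ xs
      singleton⊆ x∈xs (here y≈x) = Membershipₚ.∈-resp-≈ X (X.sym y≈x) x∈xs

      -- Both the congruence of `u` (with `xs` the singleton of `x`) and its agreement with the legs
      -- (with `y` equal to `x`) are instances.
      u-eq : ∀ {x y xs} (x∈xs : x ∈ xs) → X [ x ≈ y ] →
             L.apex [ L.ι [ y ] ⟨$⟩ (y , here X.refl) ≈ L.ι xs ⟨$⟩ (x , x∈xs) ]
      u-eq x∈xs x≈y = L.trans
        (L.sym (L.commutes (singleton⊆ (Membershipₚ.∈-resp-≈ X x≈y x∈xs)) _))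
        (Func.cong (L.ι _) (X.sym x≈y))

      u : Func X L.apex
      u = record
        { to   = λ x → L.ι [ x ] ⟨$⟩ (x , here X.refl)
        ; cong = λ x≈y → L.sym (u-eq (here X.refl) x≈y)
        }

      u-ι : ∀ xs → u ⊙ incl X (_∈ xs) ≋ L.ι xs
      u-ι xs (x , x∈xs) = u-eq x∈xs X.refl

-- Supports

module Supports {ℓ : Level} (em : ExcludedMiddle ℓ) (F : Functor ℓ)
                (finitary : IsFinitary F) (preserves : PreservesPullbacksOfMonos F) where

  open Functor F

  F-square : {A B C D : Setoid ℓ ℓ} (g : Func B D) (f : Func A B) (k : Func C D) (h : Func A C) →
             g ⊙ f ≋ k ⊙ h → ∀ a → F₀ D [ F₁ g ⟨$⟩ (F₁ f ⟨$⟩ a) ≈ F₁ k ⟨$⟩ (F₁ h ⟨$⟩ a) ]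
  F-square {D = D} g f k h gf≋kh a = begin
    F₁ g ⟨$⟩ (F₁ f ⟨$⟩ a)  ≈⟨ F-∘ g f a ⟨
    F₁ (g ⊙ f) ⟨$⟩ a       ≈⟨ F-cong gf≋kh a ⟩
    F₁ (k ⊙ h) ⟨$⟩ a       ≈⟨ F-∘ k h a ⟩
    F₁ k ⟨$⟩ (F₁ h ⟨$⟩ a)  ∎
    where open ≈-Reasoning (F₀ D)

  F-triangle : {A B D : Setoid ℓ ℓ} (g : Func B D) (f : Func A B) (h : Func A D) →
               g ⊙ f ≋ h → ∀ a → F₀ D [ F₁ g ⟨$⟩ (F₁ f ⟨$⟩ a) ≈ F₁ h ⟨$⟩ a ]
  F-triangle {D = D} g f h gf≋h a =
    Setoid.trans (F₀ D) (Setoid.sym (F₀ D) (F-∘ g f a)) (F-cong gf≋h a)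

  -- A map is injective when its kernel pair is trivial: the square with two identities over `m` is
  -- a pullback of a mono, and `F` preserves it.
  F-injective : {X Y : Setoid ℓ ℓ} (m : Func X Y) →
                Injective (Setoid._≈_ X) (Setoid._≈_ Y) (m ⟨$⟩_) →
                Injective (Setoid._≈_ (F₀ X)) (Setoid._≈_ (F₀ Y)) (F₁ m ⟨$⟩_)
  F-injective {X} {Y} m m-inj {a} {b} ma≈mb =
    let u , (u-a , u-b) , _ = IsPullback.universal Fpb (point a) (point b) (λ _ → ma≈mb)
    in  FX.trans (FX.sym (u-a tt)) (u-b tt)
    where
    module X  = Setoid X
    module FX = Setoid (F₀ X)

    pb : IsPullback idₛ idₛ m m
    pb = record
      { commutes  = λ _ → Setoid.refl Y
      ; universal = λ h k mh≋mk → h , ((λ _ → X.refl) , λ z → m-inj (mh≋mk z)) ,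
                      λ (h≋ , _) z → X.sym (h≋ z)
      }

    Fpb : IsPullback (F₁ idₛ) (F₁ idₛ) (F₁ m) (F₁ m)
    Fpb = preserves idₛ idₛ m m (λ g h mg≋mh z → m-inj (mg≋mh z)) pb

  Supports : (X : Setoid ℓ ℓ) → (∣ X ∣ → Set ℓ) → ∣ F₀ X ∣ → Set ℓ
  Supports X S a = ∃ λ b → F₀ X [ F₁ (incl X S) ⟨$⟩ b ≈ a ]

  -- The preimage square of `B` along `f` is a pullback of the mono `incl Y B`. Its image under `F`
  -- is again one, so `b` and `a` come from a common element.
  supports-preimage : {X Y : Setoid ℓ ℓ} (f : Func X Y) {B : ∣ Y ∣ → Set ℓ} →
    B Respects Setoid._≈_ Y → ∀ {a} → Supports Y B (F₁ f ⟨$⟩ a) → Supports X (λ x → B (f ⟨$⟩ x)) a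
  supports-preimage {X} {Y} f {B} B-resp {a} (b , b≈fa) =
    let u , (_ , u-a) , _ = IsPullback.universal Fpb (point b) (point a) (λ _ → b≈fa)
    in  u ⟨$⟩ tt , u-a tt
    where
    module X = Setoid X
    module Y = Setoid Y

    p : Func (Sub X (λ x → B (f ⟨$⟩ x))) (Sub Y B)
    p = restrict f (λ b → b)

    pb : IsPullback p (incl X _) (incl Y B) f
    pb = record
      { commutes  = λ _ → Y.refl
      ; universal = λ h k h≋fk →
          -- The commuting square gives `h z` and `f (k z)` only up to equality, so membership in
          -- `B` has to be transported.
          record { to   = λ z → k ⟨$⟩ z , B-resp (h≋fk z) (proj₂ (h ⟨$⟩ z))
                 ; cong = Func.cong k }
          , ((λ z → Y.sym (h≋fk z)) , λ _ → X.refl)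
          , λ (_ , k≋) z → X.sym (k≋ z)
      }

    Fpb : IsPullback (F₁ p) (F₁ (incl X _)) (F₁ (incl Y B)) (F₁ f)
    Fpb = preserves p (incl X _) (incl Y B) f (λ g h mg≋mh → mg≋mh) pb

  supports-image : {X Y : Setoid ℓ ℓ} (f : Func X Y) {S : ∣ X ∣ → Set ℓ} {T : ∣ Y ∣ → Set ℓ} →
    (∀ {x} → S x → T (f ⟨$⟩ x)) → ∀ {a} → Supports X S a → Supports Y T (F₁ f ⟨$⟩ a)
  supports-image {X} {Y} f S→T {a} (b , b≈a) = F₁ (restrict f S→T) ⟨$⟩ b ,
    Setoid.trans (F₀ Y) (F-square (incl Y _) (restrict f S→T) f (incl X _) (λ _ → Setoid.refl Y) b)
      (Func.cong (F₁ f) b≈a)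

  supports-resp-≈ : {X : Setoid ℓ ℓ} {S : ∣ X ∣ → Set ℓ} → Supports X S Respects Setoid._≈_ (F₀ X)
  supports-resp-≈ {X} a≈a′ (b , b≈a) = b , Setoid.trans (F₀ X) b≈a a≈a′

  supports-mono : {X : Setoid ℓ ℓ} {S T : ∣ X ∣ → Set ℓ} → (∀ {x} → S x → T x) →
                  ∀ {a} → Supports X S a → Supports X T a
  supports-mono S→T = supports-resp-≈ (F-id _) ∘ supports-image idₛ S→T

  -- Intersecting with `S` is taking the preimage along `incl X S`: pull `B` back to a support of
  -- the witness in `F S`, then push it forward to `X`.
  supports-∩ : {X : Setoid ℓ ℓ} {S B : ∣ X ∣ → Set ℓ} → B Respects Setoid._≈_ X →
               ∀ {a} → Supports X S a → Supports X B a → Supports X (λ x → S x × B x) a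
  supports-∩ {X} {S} B-resp (s , s≈a) supB =
    supports-resp-≈ s≈a
      (supports-image (incl X S) (λ {(x , sx)} bx → sx , bx)
        (supports-preimage (incl X S) B-resp
          (supports-resp-≈ (Setoid.sym (F₀ X) s≈a) supB)))

  module _ (X : Setoid ℓ ℓ) where

    open Membership X using (_∈_; lose)

    SupportsList : List ∣ X ∣ → ∣ F₀ X ∣ → Set ℓ
    SupportsList xs = Supports X (_∈ xs)

    finite-support : ∀ a → ∃ λ xs → SupportsList xs a
    finite-support = colimit-jointly-surjective (mapCocone F cocone)
      (finitary inclusionPoset directed diagram cocone isColimit)
      where open FiniteSubsets X

    -- Competing against all supporting lists rules out repetitions, so the length of a minimal list
    -- is the cardinality of the support.
    IsMinimalSupport : List ∣ X ∣ → ∣ F₀ X ∣ → Set ℓ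
    IsMinimalSupport xs a =
      SupportsList xs a × (∀ ys → SupportsList ys a → length xs ℕ.≤ length ys)

    minimal-support : ∀ a → ∃ λ xs → IsMinimalSupport xs a
    minimal-support a =
      let xs , sup , min = minimum em (On.wellFounded length ℕ.<-wellFounded)
                             (λ xs → SupportsList xs a) (finite-support a)
      in  xs , sup , λ ys supys → ℕ.≮⇒≥ (min ys supys)

    -- If some member of `xs` fell outside `B`, filtering `xs` by `B` would give a strictly shorter
    -- list, which supports `a` by `supports-∩`.
    minimal⇒least : ∀ {xs a} → IsMinimalSupport xs a →
                    {B : ∣ X ∣ → Set ℓ} → B Respects Setoid._≈_ X → Supports X B a →
                    ∀ {x} → x ∈ xs → B x
    minimal⇒least {xs} (sup , min) {B} B-resp supB {x} x∈xs =
      decidable-stable em λ ¬Bx → ℕ.<⇒≱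
        (filter-notAll B? xs
          (lose (λ y≈z ¬By Bz → ¬By (B-resp (Setoid.sym X y≈z) Bz)) x∈xs ¬Bx))
        (min (filter B? xs)
          (supports-mono (λ (y∈xs , By) → Membershipₚ.∈-filter⁺ X B? B-resp y∈xs By)
            (supports-∩ B-resp sup supB)))
      where
      B? : ∀ y → _
      B? y = em {B y}

-- The comparison map

module Comparison {ℓ : Level} (em : ExcludedMiddle ℓ) (F : Functor ℓ)
                  (finitary : IsFinitary F) (preserves : PreservesPullbacksOfMonos F)
                  (ρ : Ordinal ℓ) (regular : Ordinal.IsRegular ρ)
                  (uncountable : Ordinal.IsUncountable ρ)
                  (X : Diagram (Ordinal.oppositePoset ρ)) where

  open Functor F
  open Ordinal ρ hiding (_≈_)
  open OrdinalProperties em ρ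
  open Supports em F finitary preserves
  open Diagram X renaming (map to res)
  open Poset poset using () renaming (trans to ≤-trans)

  private
    module X α = Setoid (obj α)
    module FX α = Setoid (F₀ (obj α))

  res-res : ∀ {α β γ} (p : β ≤ α) (q : γ ≤ β) (r : γ ≤ α) →
            ∀ x → obj γ [ res q ⟨$⟩ (res p ⟨$⟩ x) ≈ res r ⟨$⟩ x ]
  res-res {γ = γ} p q r x = X.trans γ (X.sym γ (map-∘ p q x)) (map-cong _ r x)

  -- Injectivity: separating finitely many threads at one stage

  module _ where

    open Membership (Lim X) using (_∈_)

    -- An implication rather than an inequality, so that equal threads are separated too and all
    -- pairs from a list can be treated alike.
    Separates : Carrier → ∣ Lim X ∣ → ∣ Lim X ∣ → Set ℓ
    Separates α x y = obj α [ proj₁ x α ≈ proj₁ y α ] → Lim X [ x ≈ y ]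

    separates-upward : ∀ x y {α β} → α ≤ β → Separates α x y → Separates β x y
    separates-upward x y {α} {β} α≤β sep xβ≈yβ = sep
      (X.trans α (X.sym α (proj₂ x α≤β))
        (X.trans α (Func.cong (res α≤β) xβ≈yβ) (proj₂ y α≤β)))

    separates-resp : ∀ {α x x′ y y′} → Lim X [ x ≈ x′ ] → Lim X [ y ≈ y′ ] →
                     Separates α x y → Separates α x′ y′
    separates-resp {α} {x} {x′} {y} {y′} x≈x′ y≈y′ sep x′α≈y′α =
      trans {x′} {x} {y′} (sym {x} {x′} x≈x′) (trans {x} {y} {y′}
        (sep (X.trans α (x≈x′ α) (X.trans α x′α≈y′α (X.sym α (y≈y′ α))))) y≈y′)
      where open Setoid (Lim X) using (sym; trans)

    -- A stage where the threads differ separates them vacuously. If there is none, the threads are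
    -- equal and any stage will do.
    separates-eventually : ∀ x y → ∃ λ α → Separates α x y
    separates-eventually x y = decidable-stable em λ none →
      let x≈y : Lim X [ x ≈ y ]
          x≈y α = decidable-stable em λ xα≉yα → none (α , λ xα≈yα → contradiction xα≈yα xα≉yα)
      in  none (IsLimitOrdinal.nonZero (IsRegular.isLimit regular) , λ _ → x≈y)

    -- Two nested uses of `eventually-All`, one for each member of the pair.
    finite-separation : ∀ xs → ∃ λ α → ∀ {x y} → x ∈ xs → y ∈ xs → Separates α x y
    finite-separation xs =
      let α , sep = eventually-All α₀ (λ x α → All (Separates α x) xs)
                      (λ x α≤β → All.map (λ {y} → separates-upward x y α≤β))
                      (λ x → eventually-All α₀ (λ y α → Separates α x y)
                               (separates-upward x) (separates-eventually x) xs)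
                      xs
      in  α , λ {x} {y} x∈xs y∈xs →
        All.lookupₛ (Lim X) {P = Separates α x}
          (λ {y} {y′} → separates-resp {α} {x} {x} {y} {y′} (Setoid.refl (Lim X) {x}))
          (All.lookupₛ (Lim X) {P = λ x → All (Separates α x) xs}
            (λ {x} {x′} x≈x′ → All.map λ {y} →
              separates-resp {α} {x} {x′} {y} {y} x≈x′ (Setoid.refl (Lim X) {y}))
            sep {x} x∈xs)
          {y} y∈xs
      where α₀ = IsLimitOrdinal.nonZero (IsRegular.isLimit regular)

  comparison-injective : Injective (Setoid._≈_ (F₀ (Lim X))) (Setoid._≈_ (Lim (mapDiagram F X)))
                                   (comparison F X ⟨$⟩_)
  comparison-injective {a} {b} πa≈πb =
    let a′ , a′≈a = supports-mono (λ {x} → ∈-++⁺ˡ (Lim X) {x}) (proj₂ (finite-support (Lim X) a))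
        b′ , b′≈b = supports-mono (λ {x} → ∈-++⁺ʳ (Lim X) {x} xs) (proj₂ (finite-support (Lim X) b))
        α , sep   = finite-separation (xs ++ ys)
        proj      = F-triangle (π X α) i (π X α ⊙ i) (λ _ → X.refl α)
        -- Separation makes the projection injective on the common support, so equality at stage `α`
        -- lifts back to `F` of that support.
        a′≈b′     = F-injective (π X α ⊙ i)
          (λ {(x , x∈T)} {(y , y∈T)} → sep {x} {y} x∈T y∈T)
          (FX.trans α (FX.sym α (proj a′)) (FX.trans α (Func.cong (F₁ (π X α)) a′≈a)
            (FX.trans α (πa≈πb α)
              (FX.trans α (Func.cong (F₁ (π X α)) (FL.sym b′≈b)) (proj b′)))))
    in  FL.trans (FL.sym a′≈a) (FL.trans (Func.cong (F₁ i) a′≈b′) b′≈b)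
    where
    open Membershipₚ using (∈-++⁺ˡ; ∈-++⁺ʳ)
    module FL = Setoid (F₀ (Lim X))
    xs = proj₁ (finite-support (Lim X) a)
    ys = proj₁ (finite-support (Lim X) b)
    i  = incl (Lim X) (λ x → Membership._∈_ (Lim X) x (xs ++ ys))

  -- Surjectivity: restriction maps between least supports, and their stabilisation

  module Threads (a : ∣ Lim (mapDiagram F X) ∣) (S : ∀ α → List ∣ obj α ∣)
                 (S-minimal : ∀ α → IsMinimalSupport (obj α) (S α) (proj₁ a α)) where

    InS : ∀ α → ∣ obj α ∣ → Set ℓ
    InS α x = Membership._∈_ (obj α) x (S α)

    InS-resp : ∀ α → InS α Respects Setoid._≈_ (obj α)
    InS-resp α = Membershipₚ.∈-resp-≈ (obj α)

    -- The preimage of `S β` supports the component at `α`, so it contains the least support `S α`.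
    res-InS : ∀ {α β} (p : β ≤ α) {x} → InS α x → InS β (res p ⟨$⟩ x)
    res-InS {α} {β} p = minimal⇒least (obj α) (S-minimal α)
      (λ x≈y → InS-resp β (Func.cong (res p) x≈y))
      (supports-preimage (res p) (InS-resp β)
        (supports-resp-≈ (FX.sym β (proj₂ a p)) (proj₁ (S-minimal β))))

    image-supports : ∀ {α β} (p : β ≤ α) →
                     SupportsList (obj β) (map (res p ⟨$⟩_) (S α)) (proj₁ a β)
    image-supports {α} {β} p = supports-resp-≈ (proj₂ a p)
      (supports-image (res p) (Membershipₚ.∈-map⁺ (obj α) (obj β) (Func.cong (res p)))
        (proj₁ (S-minimal α)))

    -- The image of `S α` supports the component at `β`, so it contains the least support `S β`.
    InS-lift : ∀ {α β} (p : β ≤ α) {y} → InS β y →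
               ∃ λ x → InS α x × obj β [ y ≈ res p ⟨$⟩ x ]
    InS-lift {α} {β} p y∈S = Membershipₚ.∈-map⁻ (obj α) (obj β)
      (minimal⇒least (obj β) (S-minimal β) (Membershipₚ.∈-resp-≈ (obj β)) (image-supports p) y∈S)

    size-mono : ∀ {α β} → β ≤ α → length (S β) ℕ.≤ length (S α)
    size-mono {α} {β} p = ℕ.≤-trans (proj₂ (S-minimal β) _ (image-supports p))
      (ℕ.≤-reflexive (length-map _ (S α)))

    stabilisation : ∃ λ α₀ → ∀ α → length (S α) ℕ.≤ length (S α₀)
    stabilisation = monotone-attains-maximum regular uncountable (length ∘ S) size-mono

    module Stable (α₀ : Carrier) (maximal : ∀ α → length (S α) ℕ.≤ length (S α₀)) where

      -- If two points of S α had the same image, S α minus one of them would still cover S α₀.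
      res-injective : ∀ {α} (p : α₀ ≤ α) {x y} → InS α x → InS α y →
                      obj α₀ [ res p ⟨$⟩ x ≈ res p ⟨$⟩ y ] → obj α [ x ≈ y ]
      res-injective {α} p {x} {y} x∈S y∈S rx≈ry = decidable-stable em λ x≉y →
        ℕ.<⇒≱ T-shorter (ℕ.≤-trans (maximal α)
          (ℕ.≤-trans (proj₂ (S-minimal α₀) _ (supports-mono (covers x≉y) (proj₁ (S-minimal α₀))))
            (ℕ.≤-reflexive (length-map _ T))))
        where
        open Membership (obj α) using (_∈_)

        ≉y-resp : (λ z → ¬ obj α [ z ≈ y ]) Respects Setoid._≈_ (obj α)
        ≉y-resp z≈w z≉y w≈y = z≉y (X.trans α z≈w w≈y)

        ≉y? : ∀ z → _
        ≉y? z = em {¬ obj α [ z ≈ y ]}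

        T : List ∣ obj α ∣
        T = filter ≉y? (S α)

        T-shorter : length T ℕ.< length (S α)
        T-shorter = filter-notAll ≉y? (S α) (Any.map (λ y≈z z≉y → z≉y (X.sym α y≈z)) y∈S)

        covers : ¬ obj α [ x ≈ y ] → ∀ {z} → InS α₀ z →
                 Membership._∈_ (obj α₀) z (map (res p ⟨$⟩_) T)
        covers x≉y {z} z∈S =
          let w , w∈T , rw≈z = preimage in
          Membershipₚ.∈-resp-≈ (obj α₀) rw≈z
            (Membershipₚ.∈-map⁺ (obj α) (obj α₀) (Func.cong (res p)) w∈T)
          where
          preimage : ∃ λ w → w ∈ T × obj α₀ [ res p ⟨$⟩ w ≈ z ]
          preimage with InS-lift p z∈S
          ... | w , w∈S , z≈rw with em {obj α [ w ≈ y ]}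
          ...   | no  w≉y = w , Membershipₚ.∈-filter⁺ (obj α) ≉y? ≉y-resp w∈S w≉y , X.sym α₀ z≈rw
          -- The discarded point `y` is replaced by `x`, which survives the filter and has the same
          -- image.
          ...   | yes w≈y = x , Membershipₚ.∈-filter⁺ (obj α) ≉y? ≉y-resp x∈S x≉y ,
                  X.trans α₀ rx≈ry (X.trans α₀ (Func.cong (res p) (X.sym α w≈y)) (X.sym α₀ z≈rw))

      -- The value at `α` of the thread through `s`: lift `s` to a support above both stages, then
      -- restrict. A relation leaves the stage and the lift open.
      Extends : ∣ obj α₀ ∣ → ∀ α → ∣ obj α ∣ → Set ℓ
      Extends s α x = ∃ λ γ → ∃ λ (p : α₀ ≤ γ) → ∃ λ (q : α ≤ γ) → ∃ λ t →
        InS γ t × obj α₀ [ res p ⟨$⟩ t ≈ s ] × obj α [ res q ⟨$⟩ t ≈ x ]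

      extends-exists : ∀ {s} → InS α₀ s → ∀ α → ∃ (Extends s α)
      extends-exists s∈S α =
        let γ , p , q      = upperBound α₀ α
            t , t∈S , s≈rt = InS-lift p s∈S
        in  res q ⟨$⟩ t , γ , p , q , t , t∈S , X.sym α₀ s≈rt , X.refl α

      -- Both lifts are lifted further to one stage `δ`; there they agree, since `res-injective`
      -- makes them determined by their images at `α₀`. Allowing `s` and `s′` to differ also yields
      -- the congruence of `thread`.
      extends-unique : ∀ {s s′ α x x′} → Extends s α x → Extends s′ α x′ →
                       obj α₀ [ s ≈ s′ ] → obj α [ x ≈ x′ ]
      extends-unique {s} {s′} {α} {x} {x′} (γ , p , q , t , t∈S , pt≈s , qt≈x)
                     (γ′ , p′ , q′ , t′ , t′∈S , pt′≈s′ , qt′≈x′) s≈s′ =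
        let δ , g , g′       = upperBound γ γ′
            u , u∈S , t≈gu   = InS-lift g t∈S
            u′ , u′∈S , t′≈gu′ = InS-lift g′ t′∈S
            r                = ≤-trans p g
            r′               = ≤-trans q g
            u≈u′ = res-injective r u∈S u′∈S (X.trans α₀ (descend p g r t≈gu pt≈s)
                     (X.trans α₀ s≈s′ (X.sym α₀ (descend p′ g′ r t′≈gu′ pt′≈s′))))
        in  X.trans α (X.sym α (descend q g r′ t≈gu qt≈x))
              (X.trans α (Func.cong (res r′) u≈u′) (descend q′ g′ r′ t′≈gu′ qt′≈x′))
        where
        descend : ∀ {α γ δ t u y} (p : α ≤ γ) (g : γ ≤ δ) (r : α ≤ δ) →
                  obj γ [ t ≈ res g ⟨$⟩ u ] → obj α [ res p ⟨$⟩ t ≈ y ] → obj α [ res r ⟨$⟩ u ≈ y ]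
        descend {α} p g r t≈gu pt≈y = X.trans α (X.sym α (res-res g p r _))
          (X.trans α (Func.cong (res p) (X.sym _ t≈gu)) pt≈y)

      extends-res : ∀ {s α β x} (p : β ≤ α) → Extends s α x → Extends s β (res p ⟨$⟩ x)
      extends-res {β = β} p (γ , q , r , t , t∈S , qt≈s , rt≈x) =
        γ , q , ≤-trans p r , t , t∈S , qt≈s ,
        X.trans β (X.sym β (res-res r p (≤-trans p r) t)) (Func.cong (res p) rt≈x)

      thread : Func (Sub (obj α₀) (InS α₀)) (Lim X)
      thread = record
        { to   = λ (s , s∈S) →
            (λ α → proj₁ (extends-exists s∈S α)) ,
            λ {α} {β} p → extends-unique (extends-res p (proj₂ (extends-exists s∈S α)))
                            (proj₂ (extends-exists s∈S β)) (X.refl α₀)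
        ; cong = λ { {_ , s∈S} {_ , s′∈S} s≈s′ α →
            extends-unique (proj₂ (extends-exists s∈S α)) (proj₂ (extends-exists s′∈S α)) s≈s′ }
        }

      preimage : ∣ F₀ (Lim X) ∣
      preimage = F₁ thread ⟨$⟩ proj₁ (proj₁ (S-minimal α₀))

      -- The stage `α` may lie on either side of `α₀`, so the computation passes through a stage `γ`
      -- above both.
      comparison-preimage : Lim (mapDiagram F X) [ comparison F X ⟨$⟩ preimage ≈ a ]
      comparison-preimage α = begin
        F₁ (π X α) ⟨$⟩ (F₁ thread ⟨$⟩ b₀)
          ≈⟨ Func.cong (F₁ (π X α)) (Func.cong (F₁ thread) b₀≈) ⟩
        F₁ (π X α) ⟨$⟩ (F₁ thread ⟨$⟩ (F₁ r ⟨$⟩ b))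
          ≈⟨ Func.cong (F₁ (π X α)) (F-∘ thread r b) ⟨
        F₁ (π X α) ⟨$⟩ (F₁ (thread ⊙ r) ⟨$⟩ b)
          ≈⟨ F-square (π X α) (thread ⊙ r) (res q) (incl (obj γ) (InS γ)) thread-r b ⟩
        F₁ (res q) ⟨$⟩ (F₁ (incl (obj γ) (InS γ)) ⟨$⟩ b)
          ≈⟨ Func.cong (F₁ (res q)) b≈a ⟩
        F₁ (res q) ⟨$⟩ proj₁ a γ
          ≈⟨ proj₂ a q ⟩
        proj₁ a α ∎
        where
        open ≈-Reasoning (F₀ (obj α))

        γ = proj₁ (upperBound α₀ α)
        p = proj₁ (proj₂ (upperBound α₀ α))
        q = proj₂ (proj₂ (upperBound α₀ α))

        r : Func (Sub (obj γ) (InS γ)) (Sub (obj α₀) (InS α₀))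
        r = restrict (res p) (res-InS p)

        b₀   = proj₁ (proj₁ (S-minimal α₀))
        b    = proj₁ (proj₁ (S-minimal γ))
        b≈a  = proj₂ (proj₁ (S-minimal γ))

        -- `F` of the inclusion of `S α₀` is injective, and both sides are sent to the component of
        -- `a` at `α₀`.
        b₀≈ : F₀ (Sub (obj α₀) (InS α₀)) [ b₀ ≈ F₁ r ⟨$⟩ b ]
        b₀≈ = F-injective (incl (obj α₀) (InS α₀)) (λ x≈y → x≈y)
          (FX.trans α₀ (proj₂ (proj₁ (S-minimal α₀)))
            (FX.sym α₀ (proj₂ (supports-resp-≈ (proj₂ a p)
              (supports-image (res p) (res-InS p) (proj₁ (S-minimal γ)))))))

        -- The point `t` itself witnesses that the thread through `res p ⟨$⟩ t` has value
        -- `res q ⟨$⟩ t` at `α`.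
        thread-r : π X α ⊙ (thread ⊙ r) ≋ res q ⊙ incl (obj γ) (InS γ)
        thread-r (t , t∈S) = extends-unique (proj₂ (extends-exists (res-InS p t∈S) α))
          (γ , p , q , t , t∈S , X.refl α₀ , X.refl α) (X.refl α₀)

  comparison-strictlySurjective : StrictlySurjective (Setoid._≈_ (Lim (mapDiagram F X)))
                                                     (comparison F X ⟨$⟩_)
  comparison-strictlySurjective a = preimage , comparison-preimage
    where
    open Threads a (λ α → proj₁ (minimal-support (obj α) (proj₁ a α)))
                   (λ α → proj₂ (minimal-support (obj α) (proj₁ a α)))
    open Stable (proj₁ stabilisation) (proj₂ stabilisation)

mainTheorem1 : {ℓ : Level} → ExcludedMiddle ℓ →
    (F : Functor ℓ) → IsFinitary F → PreservesPullbacksOfMonos F →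
    (ρ : Ordinal ℓ) → Ordinal.IsRegular ρ → Ordinal.IsUncountable ρ →
    (X : Diagram (Ordinal.oppositePoset ρ)) →
    Bijective (Setoid._≈_ (Functor.F₀ F (Lim X))) (Setoid._≈_ (Lim (mapDiagram F X))) (comparison F X ⟨$⟩_)
mainTheorem1 em F finitary preserves ρ regular uncountable X =
  comparison-injective ,
  strictlySurjective⇒surjective (Functor.F₀ F (Lim X)) (Lim (mapDiagram F X))
    {f = comparison F X ⟨$⟩_}
    (λ {a} {b} → Func.cong (comparison F X) {a} {b}) comparison-strictlySurjective
  where open Comparison em F finitary preserves ρ regular uncountable X
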